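{- Let $t \ge 4$ be an integer and let $G$ be a $t$-tough graph on $n \ge 3$ vertices with (non-decreasing) degree sequence $d_1, d_2, \dots, d_n$. Suppose that for all positive integers $i < \frac{n}{2}$, $d_i \le i$ implies $d_{n-i+t} \ge n-i$. Then $G$ is Hamiltonian.
   Context: Graphs are simple, undirected and finite. A non-decreasing sequence $d_1 \le d_2 \le \dots \le d_n$ is a degree sequence of a graph $G$ if the vertices of $G$ can be labeled $v_1, \dots, v_n$ such that $\deg(v_i) = d_i$ for all $i$. Let $c(H)$ denote the number of components of a graph $H$. For a real number $t \ge 0$, $G$ is $t$-tough if $|S| \ge t \cdot c(G-S)$ for all $S \subseteq V(G)$ with $c(G-S) \ge 2$ (so complete graphs are $t$-tough for every $t$). A graph is Hamiltonian if it has a cycle containing all its vertices. (For the $t$-tough graphs considered here, $d_i \le i$ with $i < n/2$ can only occur when $i \ge t$, so the index $n-i+t$ is at most $n$ whenever it is used.) -}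

module Defs where

open import Level using (Level; 0ℓ)
import Data.Bool.Properties as Bool
open import Data.Nat using (ℕ; suc; _*_; _≤_)
open import Data.Fin as Fin using (Fin; toℕ)
import Data.Fin.Properties as Fin
open import Data.Fin.Permutation using (Permutation′; _⟨$⟩ʳ_)
open import Data.Fin.Subset using (Subset; ∣_∣)
open import Data.Fin.Subset.Properties using (_∈?_)
open import Data.List using (List; []; _∷_; _∷ʳ_; length; map; filter; lookup; allFin; deduplicate)
open import Data.List.Membership.Propositional using (_∈_)
open import Data.List.Membership.Propositional.Properties using (∈-allFin)
open import Data.List.Relation.Unary.Any using (here; there)
open import Data.List.Relation.Unary.Linked using (Linked)
open import Data.List.Relation.Unary.Unique.Propositional using (Unique)
open import Data.Product using (Σ; _×_; _,_)
open import Data.Sum using (_⊎_; inj₁; inj₂)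
import Data.Vec as Vec
import Data.Vec.Properties as Vec
open import Function using (_∘_)
open import Relation.Binary.Core using (Rel)
open import Relation.Binary.Definitions using (Decidable; Symmetric; Irreflexive)
open import Relation.Binary.Construct.Closure.ReflexiveTransitive using (Star; ε; _◅_; _◅◅_)
open import Relation.Binary.PropositionalEquality using (_≡_; refl; cong)
open import Relation.Nullary.Decidable using (does; ¬?; map′; _⊎-dec_; _×-dec_)

-- Decidability of reachability on Fin n, by Warshall's algorithm.
module _ {ℓ : Level} {n : ℕ} {R : Rel (Fin n) ℓ} (R? : Decidable R) where

  -- Through ws u v: some walk from u to v has all its inner vertices in ws.
  Through : List (Fin n) → Rel (Fin n) ℓ
  Through []       u v = u ≡ v ⊎ R u v
  Through (w ∷ ws) u v = Through ws u v ⊎ (Through ws u w × Through ws w v)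

  through? : ∀ ws → Decidable (Through ws)
  through? []       u v = (u Fin.≟ v) ⊎-dec R? u v
  through? (w ∷ ws) u v = through? ws u v ⊎-dec (through? ws u w ×-dec through? ws w v)

  through⇒star : ∀ ws {u v} → Through ws u v → Star R u v
  through⇒star []       (inj₁ refl)    = ε
  through⇒star []       (inj₂ r)       = r ◅ ε
  through⇒star (w ∷ ws) (inj₁ p)       = through⇒star ws p
  through⇒star (w ∷ ws) (inj₂ (p , q)) = through⇒star ws p ◅◅ through⇒star ws q

  through-refl : ∀ ws {u} → Through ws u u
  through-refl []       = inj₁ refl
  through-refl (w ∷ ws) = inj₁ (through-refl ws)

  through-edge : ∀ ws {u v} → R u v → Through ws u v
  through-edge []       r = inj₂ r
  through-edge (w ∷ ws) r = inj₁ (through-edge ws r)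

  through-from : ∀ {w ws v} → Through (w ∷ ws) w v → Through ws w v
  through-from (inj₁ p)       = p
  through-from (inj₂ (_ , q)) = q

  through-to : ∀ {w ws u} → Through (w ∷ ws) u w → Through ws u w
  through-to (inj₁ p)       = p
  through-to (inj₂ (p , _)) = p

  through-trans : ∀ {ws u w v} → w ∈ ws → Through ws u w → Through ws w v → Through ws u v
  through-trans (here refl) p q = inj₂ (through-to p , through-from q)
  through-trans (there w∈)  (inj₁ p)       (inj₁ q)       = inj₁ (through-trans w∈ p q)
  through-trans (there w∈)  (inj₁ p)       (inj₂ (q , r)) = inj₂ (through-trans w∈ p q , r)
  through-trans (there w∈)  (inj₂ (p , q)) (inj₁ r)       = inj₂ (p , through-trans w∈ q r)
  through-trans (there w∈)  (inj₂ (p , _)) (inj₂ (_ , r)) = inj₂ (p , r)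

  star⇒through : ∀ {u v} → Star R u v → Through (allFin n) u v
  star⇒through ε        = through-refl (allFin n)
  star⇒through (_◅_ {j = w} r rs) =
    through-trans (∈-allFin w) (through-edge (allFin n) r) (star⇒through rs)

  star? : Decidable (Star R)
  star? u v = map′ (through⇒star (allFin n)) star⇒through (through? (allFin n) u v)

record Graph (n : ℕ) : Set₁ where
  infix 4 _~_ _~?_
  field
    _~_    : Rel (Fin n) 0ℓ
    _~?_   : Decidable _~_
    sym    : Symmetric _~_
    irrefl : Irreflexive _≡_ _~_

  neighbours : Fin n → Subset n
  neighbours v = Vec.tabulate (λ u → does (v ~? u))

  degree : Fin n → ℕ
  degree v = ∣ neighbours v ∣

  Connected : Rel (Fin n) 0ℓ
  Connected = Star _~_

  connected? : Decidable Connected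
  connected? = star? _~?_

  component : Fin n → Subset n
  component v = Vec.tabulate (λ u → does (connected? v u))

  components : List (Subset n)
  components = deduplicate (Vec.≡-dec Bool._≟_) (map component (allFin n))

  c : ℕ
  c = length components

  record Cycle : Set where
    field
      start    : Fin n
      rest     : List (Fin n)
      distinct : Unique (start ∷ rest)
      long     : 3 ≤ length (start ∷ rest)
      closed   : Linked _~_ (start ∷ rest ∷ʳ start)

    vertices : List (Fin n)
    vertices = start ∷ rest

  Hamiltonian : Set
  Hamiltonian = Σ Cycle λ C → ∀ v → v ∈ Cycle.vertices C

open Graph public using (degree; c; Hamiltonian)

remaining : ∀ {n} → Subset n → List (Fin n)
remaining {n} S = filter (λ v → ¬? (v ∈? S)) (allFin n)

-- The vertices outside S are renumbered: vertex k of G - S is the k-th of them.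
infixl 6 _-_
_-_ : ∀ {n} → Graph n → (S : Subset n) → Graph (length (remaining S))
G - S = record
  { _~_    = λ i j → lookup vs i ~ lookup vs j
  ; _~?_   = λ i j → lookup vs i ~? lookup vs j
  ; sym    = sym
  ; irrefl = λ i≡j → irrefl (cong (lookup vs) i≡j)
  }
  where
  open Graph G
  vs = remaining S

Tough : ∀ {n} → ℕ → Graph n → Set
Tough {n} t G = (S : Subset n) → 2 ≤ c (G - S) → t * c (G - S) ≤ ∣ S ∣

record IsDegreeSequence {n : ℕ} (G : Graph n) (d : Fin n → ℕ) : Set where
  field
    monotone  : ∀ {i j} → i Fin.≤ j → d i ≤ d j
    labelling : Permutation′ n
    degrees   : ∀ i → degree G (labelling ⟨$⟩ʳ i) ≡ d i

-- Degree sequences are indexed from 1 in the literature.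
index : ∀ {n} → Fin n → ℕ
index i = suc (toℕ i)

{-# OPTIONS --safe #-}
-- Argue by induction on the number of non-adjacent pairs. If G is not complete, let y be a vertex of
-- largest degree D among those that are not universal, and x a non-neighbour of y of largest degree i.
-- By induction G + xy is Hamiltonian, so we may assume that G has a Hamiltonian path from x to y.
-- Let q = n - 1 - D count the non-neighbours of y; all of them have degree at most i, and Ore's rotation
-- argument gives i ≤ q. For k = min (q , ⌊(n - 1)/2⌋) we have i ≤ k and d_k ≤ k, so at least k + 1 - t
-- vertices have degree at least n - k > D; these are universal. Let ω be the number of universal vertices.
--
-- If G is not Hamiltonian, the ω predecessors of the universal vertices on the path are independent and
-- not adjacent to y, so each has degree at most i ≤ ω + t - 1, hence at most t - 1 neighbours which
-- are not universal. Deleting all their neighbours, at most ω + ω (t - 1) = ω t vertices, leaves at least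
-- ω + 1 components, contrary to toughness; for ω = 0, delete the i ≤ k < t neighbours of x instead.
module Submission where

open import Defs
open import Data.Bool using (true; false)
import Data.Bool.Properties as Bool
open import Data.Empty using (⊥; ⊥-elim)
open import Data.Nat using (ℕ; zero; suc; pred; >-nonZero; _+_; _*_; _∸_; _⊓_; ⌊_/2⌋; ⌈_/2⌉;
                            _≤_; _<_; z≤n; s≤s)
open import Data.Nat.Induction using (<-wellFounded)
import Data.Nat.Properties as ℕ
open import Data.Fin using (Fin; toℕ; inject)
import Data.Fin as Fin
import Data.Fin.Properties as Fin
open import Data.Fin.Permutation using (_⟨$⟩ʳ_; _⟨$⟩ˡ_; inverseʳ)
open import Data.Fin.Subset using (Subset; ∣_∣)
import Data.Fin.Subset as Subset
open import Data.List using (List; []; _∷_; _++_; _∷ʳ_; [_]; length; map; filter; lookup; allFin; tabulate;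
                             concatMap; reverse; cartesianProduct)
import Data.List.Properties as List
open import Data.List.Membership.Propositional using (_∈_; _∉_; find; lose)
open import Data.List.Membership.Propositional.Properties
open import Data.List.Relation.Binary.Permutation.Propositional using (_↭_; ↭-sym; ↭-trans; ↭⇒↭ₛ)
import Data.List.Relation.Binary.Permutation.Propositional.Properties as ↭
open import Data.List.Relation.Binary.Subset.Propositional using (_⊆_)
open import Data.List.Relation.Unary.All as All using (All; []; _∷_)
open import Data.List.Relation.Unary.AllPairs as AllPairs using (AllPairs; []; _∷_)
import Data.List.Relation.Unary.AllPairs.Properties as AllPairs
open import Data.List.Relation.Unary.Any as Any using (here; there)
open import Data.List.Relation.Unary.Any.Properties using (lookup-index)
open import Data.List.Relation.Unary.Linked using (Linked; [-]; _∷_)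
open import Data.List.Relation.Unary.Unique.Propositional using (Unique)
import Data.List.Relation.Unary.Unique.Propositional.Properties as Unique
import Data.List.Relation.Unary.Unique.DecPropositional.Properties as DecUnique
open import Data.Product using (Σ; ∃; _×_; _,_; proj₁; proj₂)
open import Data.Sum using (_⊎_; inj₁; inj₂; [_,_]′)
import Data.Vec as Vec
import Data.Vec.Properties as Vec
open import Induction.WellFounded using (Acc; acc)
open import Function using (_∘_; id)
open import Function.Bundles using (mk⇔)
open import Level using (Level; 0ℓ)
open import Relation.Binary.Construct.Closure.ReflexiveTransitive as Star using (Star; ε; _◅_; _◅◅_)
open import Relation.Binary.Core using (Rel)
open import Relation.Binary.PropositionalEquality using (_≡_; _≢_; refl; sym; trans; cong; subst; subst₂; setoid)
open import Relation.Nullary using (¬_; Dec; yes; no; does; contradiction)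
open import Relation.Nullary.Decidable using (¬?; _×-dec_; _⊎-dec_; does-⇔; decidable-stable)
open import Relation.Unary using (Pred; Decidable)

-- Lists and counting

private variable
  ℓ : Level
  A B : Set ℓ
  n : ℕ

length-mono-⊆ : {xs ys : List A} → Unique xs → xs ⊆ ys → length xs ≤ length ys
length-mono-⊆ {xs = []} _ _ = z≤n
length-mono-⊆ {xs = x ∷ xs} {ys} (x∉ ∷ u) sub
  with as , bs , refl ← ∈-∃++ (sub (here refl)) =
  subst (suc (length xs) ≤_) (sym (↭.↭-length (↭.shift x as bs))) (s≤s (length-mono-⊆ u sub′))
  where
  sub′ : xs ⊆ as ++ bs
  sub′ z∈ with ∈-++⁻ as (sub (there z∈))
  ... | inj₁ z∈as         = ∈-++⁺ˡ z∈as
  ... | inj₂ (there z∈bs) = ∈-++⁺ʳ as z∈bs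
  ... | inj₂ (here refl)  = contradiction refl (All.lookup x∉ z∈)

map-preimage : (f : A → B) {ys : List B} → All (λ y → ∃ λ x → f x ≡ y) ys → ∃ λ xs → map f xs ≡ ys
map-preimage f []               = [] , refl
map-preimage f ((x , refl) ∷ p) with xs , refl ← map-preimage f p = x ∷ xs , refl

length-concatMap-≤ : (f : A → List B) {r : ℕ} {xs : List A} →
                     All (λ x → length (f x) ≤ r) xs → length (concatMap f xs) ≤ length xs * r
length-concatMap-≤ f [] = z≤n
length-concatMap-≤ f {r} {x ∷ xs} (p ∷ ps) =
  subst (_≤ r + length xs * r) (sym (List.length-++ (f x))) (ℕ.+-mono-≤ p (length-concatMap-≤ f ps))

Unique-++⇒disjoint : ∀ {as bs : List A} {v} → Unique (as ++ bs) → v ∈ as → v ∉ bs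
Unique-++⇒disjoint {as = a ∷ as} uq       (here refl) v∈bs = Unique.Unique[x∷xs]⇒x∉xs uq (∈-++⁺ʳ as v∈bs)
Unique-++⇒disjoint {as = a ∷ as} (_ ∷ uq) (there v∈)  v∈bs = Unique-++⇒disjoint uq v∈ v∈bs

Unique-map⁺ : {f : A → B} {xs : List A} → (∀ {u v} → u ∈ xs → v ∈ xs → f u ≡ f v → u ≡ v) →
              Unique xs → Unique (map f xs)
Unique-map⁺ inj []        = []
Unique-map⁺ {f = f} {x ∷ xs} inj (x∉ ∷ uq) =
  All.tabulate (λ z∈ fx≡z → let v , v∈ , z≡fv = ∈-map⁻ f z∈ in
    All.lookup x∉ v∈ (inj (here refl) (there v∈) (trans fx≡z z≡fv)))
  ∷ Unique-map⁺ (λ u∈ v∈ → inj (there u∈) (there v∈)) uq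

filter-complement : {P : Pred A ℓ} (P? : Decidable P) (xs : List A) →
                    length (filter P? xs) + length (filter (¬? ∘ P?) xs) ≡ length xs
filter-complement P? []       = refl
filter-complement P? (x ∷ xs) with does (P? x)
... | true  = cong suc (filter-complement P? xs)
... | false = trans (ℕ.+-suc _ _) (cong suc (filter-complement P? xs))

module _ {P : Pred (Fin n) ℓ} (P? : Decidable P) where

  members : List (Fin n)
  members = filter P? (allFin n)

  # : ℕ
  # = length members

  members-unique : Unique members
  members-unique = Unique.filter⁺ P? (Unique.allFin⁺ n)

  ∈-members⁺ : ∀ {v} → P v → v ∈ members
  ∈-members⁺ {v} = ∈-filter⁺ P? (∈-allFin v)

  ∈-members⁻ : ∀ {v} → v ∈ members → P v
  ∈-members⁻ = proj₂ ∘ ∈-filter⁻ P? {xs = allFin n}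

  length≤# : ∀ {xs} → Unique xs → (∀ {v} → v ∈ xs → P v) → length xs ≤ #
  length≤# u sub = length-mono-⊆ u (∈-members⁺ ∘ sub)

  #≤length : ∀ {xs} → (∀ {v} → P v → v ∈ xs) → # ≤ length xs
  #≤length sub = length-mono-⊆ members-unique (sub ∘ ∈-members⁻)

  subsetOf : Subset n
  subsetOf = Vec.tabulate (does ∘ P?)

  ∈-subsetOf⁺ : ∀ {v} → P v → v Subset.∈ subsetOf
  ∈-subsetOf⁺ {v} p with P? v in eq
  ... | yes _  = Vec.lookup⇒[]= v _ (trans (Vec.lookup∘tabulate (does ∘ P?) v) (cong does eq))
  ... | no ¬p = contradiction p ¬p

  ∈-subsetOf⁻ : ∀ {v} → v Subset.∈ subsetOf → P v
  ∈-subsetOf⁻ {v} v∈ with P? v | trans (sym (Vec.lookup∘tabulate (does ∘ P?) v)) (Vec.[]=⇒lookup v∈)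
  ... | yes p | _ = p

#-mono : {P Q : Pred (Fin n) ℓ} (P? : Decidable P) (Q? : Decidable Q) →
         (∀ {v} → P v → Q v) → # P? ≤ # Q?
#-mono P? Q? P⇒Q = length≤# Q? (members-unique P?) (P⇒Q ∘ ∈-members⁻ P?)

∣subsetOf∣ : {P : Pred (Fin n) ℓ} (P? : Decidable P) → ∣ subsetOf P? ∣ ≡ # P?
∣subsetOf∣ P? = go P? id
  where
  go : ∀ {m} {P : Pred A ℓ} (P? : Decidable P) (f : Fin m → A) →
       ∣ Vec.tabulate (does ∘ P? ∘ f) ∣ ≡ length (filter P? (tabulate f))
  go {m = zero}  P? f = refl
  go {m = suc m} P? f with does (P? (f Fin.zero))
  ... | true  = cong suc (go P? (f ∘ Fin.suc))
  ... | false = go P? (f ∘ Fin.suc)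

#-complement : {P : Pred (Fin n) ℓ} (P? : Decidable P) → # P? + # (¬? ∘ P?) ≡ n
#-complement {n} P? = trans (filter-complement P? (allFin n)) (List.length-tabulate id)

maximal : {P : Pred (Fin n) ℓ} (P? : Decidable P) (f : Fin n → ℕ) → ∃ P →
          ∃ λ v → P v × (∀ {u} → P u → f u ≤ f v)
maximal P? f (w , pw) =
  argmax f w (members P?) ,
  argmax-all f pw (All.tabulate (∈-members⁻ P?)) ,
  λ pu → All.lookup (f[xs]≤f[argmax] w (members P?)) (∈-members⁺ P? pu)
  where
  open import Data.List.Extrema ℕ.≤-totalOrder using (argmax; argmax-all; f[xs]≤f[argmax])

-- Components and toughness

module _ (G : Graph n) where
  open Graph G using (_~?_; Connected; connected?; component; components)

  connected-sym : ∀ {u v} → Connected u v → Connected v u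
  connected-sym = Star.reverse (Graph.sym G)

  component-cong : ∀ {u v} → Connected u v → component u ≡ component v
  component-cong {u} {v} p = Vec.tabulate-cong λ w →
    does-⇔ (mk⇔ (connected-sym p ◅◅_) (p ◅◅_)) (connected? u w) (connected? v w)

  component-injective : ∀ {u v} → component u ≡ component v → Connected u v
  component-injective {u} {v} eq =
    ∈-subsetOf⁻ (connected? u) (subst (v Subset.∈_) (sym eq) (∈-subsetOf⁺ (connected? v) ε))

  Separated : List (Fin n) → Set
  Separated = AllPairs (λ u v → ¬ Connected u v)

  -- Together with `representatives`, this makes `c G` the largest size of a pairwise disconnected
  -- family, so later arguments never touch the deduplicated list.
  separated⇒≤c : ∀ {us} → Separated us → length us ≤ c G
  separated⇒≤c {us} sep = subst (_≤ c G) (List.length-map component us)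
    (length-mono-⊆ (AllPairs.map⁺ (AllPairs.map (_∘ component-injective) sep)) sub)
    where
    sub : map component us ⊆ components
    sub z∈ with u , _ , refl ← ∈-map⁻ component z∈ =
      ∈-deduplicate⁺ (Vec.≡-dec Bool._≟_) (∈-map⁺ component (∈-allFin u))

  representatives : ∃ λ us → Separated us × length us ≡ c G
  representatives
    with us , eq ← map-preimage component {components} (All.tabulate λ z∈ →
           let u , _ , eq = ∈-map⁻ component (∈-deduplicate⁻ (Vec.≡-dec Bool._≟_) (map component (allFin n)) z∈)
           in u , sym eq) =
    us ,
    AllPairs.map (_∘ component-cong)
      (AllPairs.map⁻ (subst Unique (sym eq) (DecUnique.deduplicate-! (Vec.≡-dec Bool._≟_) (map component (allFin n))))) ,
    trans (sym (List.length-map component us)) (cong length eq)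

  degree≡# : ∀ v → degree G v ≡ # (v ~?_)
  degree≡# v = ∣subsetOf∣ (v ~?_)

-- Walks of `G` are walks of `H`, so representatives of the components of `H` stay pairwise
-- disconnected in `G`.
c-antitone : {G H : Graph n} → (∀ {u v} → Graph._~_ G u v → Graph._~_ H u v) → c H ≤ c G
c-antitone {G = G} {H} G⊆H with us , sep , eq ← representatives H =
  subst (_≤ c G) eq (separated⇒≤c G (AllPairs.map (_∘ Star.map G⊆H) sep))

tough-mono : {t : ℕ} {G H : Graph n} → (∀ {u v} → Graph._~_ G u v → Graph._~_ H u v) → Tough t G → Tough t H
tough-mono {t = t} {G} {H} G⊆H tough S 2≤c =
  ℕ.≤-trans (ℕ.*-monoʳ-≤ t c≤) (tough S (ℕ.≤-trans 2≤c c≤))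
  where
  c≤ : c (H - S) ≤ c (G - S)
  c≤ = c-antitone {G = G - S} {H - S} G⊆H

-- Only the later member of each pair has to satisfy `P`, so the head `u` is exempt;
-- `tough-isolated` uses this for `y`.
AllPairs-strengthen : {P : Pred A 0ℓ} {R T : Rel A 0ℓ} → (∀ {u v} → P v → R u v → T u v) →
                      ∀ {u us} → All P us → AllPairs R (u ∷ us) → AllPairs T (u ∷ us)
AllPairs-strengthen f []       (_ ∷ _)  = [] ∷ []
AllPairs-strengthen f (p ∷ ps) (r ∷ rs) =
  All.zipWith (λ (p , r) → f p r) (p ∷ ps , r) ∷ AllPairs-strengthen f ps rs

-- Each vertex of `us` is a component of `G - S` by itself, and `y`, whose neighbours are arbitrary,
-- accounts for one more.
tough-isolated : (t : ℕ) (G : Graph n) → Tough t G →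
                 (S : Subset n) {y : Fin n} {us : List (Fin n)} → Unique (y ∷ us) →
                 All (Subset._∉ S) (y ∷ us) →
                 All (λ u → ∀ w → Graph._~_ G u w → w Subset.∈ S) us →
                 1 ≤ length us → t * suc (length us) ≤ ∣ S ∣
tough-isolated {n} t G tough S {y} {us} unique outside isolated 1≤
  with map-preimage (lookup (remaining S)) (All.map kept outside)
  where
  kept : ∀ {v} → v Subset.∉ S → ∃ λ k → lookup (remaining S) k ≡ v
  kept {v} v∉ = Any.index v∈ , sym (lookup-index v∈)
    where
    v∈ : v ∈ remaining S
    v∈ = ∈-filter⁺ _ (∈-allFin v) v∉
... | k ∷ ks , refl = ℕ.≤-trans (ℕ.*-monoʳ-≤ t suc≤c) (tough S (ℕ.≤-trans (s≤s 1≤) suc≤c))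
  where
  open Graph (G - S) using (Connected)

  stuck : ∀ {i j} → (∀ w → Graph._~_ G (lookup (remaining S) j) w → w Subset.∈ S) → Connected j i → i ≡ j
  stuck iso ε = refl
  -- The first edge of such a walk would end in `S`, whereas the vertices of `G - S` come from
  -- outside `S`.
  stuck iso (_◅_ {j = l} e _) = contradiction (iso _ e) (proj₂ (∈-filter⁻ _ {xs = allFin n} (∈-lookup {xs = remaining S} l)))

  separated : Separated (G - S) (k ∷ ks)
  separated = AllPairs-strengthen
    (λ iso i≢j i⇝j → i≢j (cong (lookup (remaining S)) (stuck iso (connected-sym (G - S) i⇝j))))
    (All.tabulate λ i∈ → All.lookup isolated (∈-map⁺ (lookup (remaining S)) i∈))
    (AllPairs.map⁻ unique)

  suc≤c : suc (length (map (lookup (remaining S)) ks)) ≤ c (G - S)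
  suc≤c = subst (λ l → suc l ≤ c (G - S)) (sym (List.length-map _ ks)) (separated⇒≤c (G - S) separated)

-- Degree sequences

-- The hypothesis of the theorem in terms of numbers of vertices, which makes it visibly monotone in G.
DegreeCondition : ℕ → Graph n → Set
DegreeCondition {n} t G = ∀ k → 1 ≤ k → 2 * k < n →
  k ≤ # (λ v → degree G v ℕ.≤? k) → suc k ≤ # (λ v → n ∸ k ℕ.≤? degree G v) + t

module _ {G : Graph n} {d : Fin n → ℕ} (isDegSeq : IsDegreeSequence G d) where
  open IsDegreeSequence isDegSeq

  position : Fin n → Fin n
  position v = labelling ⟨$⟩ˡ v

  degree-position : ∀ v → degree G v ≡ d (position v)
  degree-position v = trans (cong (degree G) (sym (inverseʳ labelling))) (degrees (position v))

  d-mono-< : ∀ {i j} → d i < d j → i Fin.< j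
  d-mono-< di<dj = ℕ.≰⇒> λ j≤i → ℕ.<⇒≱ di<dj (monotone j≤i)

  #≤toℕ : {P : Pred (Fin n) 0ℓ} (P? : Decidable P) (i : Fin n) →
          (∀ {v} → P v → position v Fin.< i) → # P? ≤ toℕ i
  #≤toℕ P? i before = subst (# P? ≤_) (List.length-tabulate label) (#≤length P? λ {v} pv →
      subst (_∈ tabulate label) (label-position (before pv)) (∈-tabulate⁺ (Fin.fromℕ< (before pv))))
    where
    label : Fin (toℕ i) → Fin n
    label j = labelling ⟨$⟩ʳ inject j

    label-position : ∀ {v} (lt : position v Fin.< i) → label (Fin.fromℕ< lt) ≡ v
    label-position lt = trans
      (cong (labelling ⟨$⟩ʳ_) (Fin.toℕ-injective (trans (Fin.toℕ-inject _) (Fin.toℕ-fromℕ< lt))))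
      (inverseʳ labelling)

  -- If `d i` exceeded `k`, monotonicity would put all vertices of degree at most `k` before `i`,
  -- where there are only `toℕ i` positions, one fewer than `index i`.
  #≥⇒d≤ : ∀ {k} i → index i ≤ # (λ v → degree G v ℕ.≤? k) → d i ≤ k
  #≥⇒d≤ i le = ℕ.≮⇒≥ λ k<di → ℕ.<⇒≱ le (#≤toℕ _ i λ {v} deg≤k →
    d-mono-< (ℕ.≤-<-trans (subst (_≤ _) (degree-position v) deg≤k) k<di))

  -- The vertices of degree below `b` all sit before `j`.
  d≥⇒#≥ : ∀ {b} j → b ≤ d j → n ≤ # (λ v → b ℕ.≤? degree G v) + toℕ j
  d≥⇒#≥ {b} j b≤dj = subst (_≤ # b≤deg? + toℕ j) (#-complement b≤deg?)
    (ℕ.+-monoʳ-≤ (# b≤deg?) (#≤toℕ _ j λ {v} b≰deg →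
      d-mono-< (subst (_< d j) (degree-position v) (ℕ.<-≤-trans (ℕ.≰⇒> b≰deg) b≤dj))))
    where
    b≤deg? : Decidable (λ v → b ≤ degree G v)
    b≤deg? v = b ℕ.≤? degree G v

  -- Since n - (n - k + t) + 1 = k + 1 - t, the literal conclusion provides k + 1 - t vertices of
  -- degree at least n - k; `DegreeCondition` moves `t` to the other side to avoid truncated
  -- subtraction.
  degreeCondition : ∀ {t} →
    (∀ (i j : Fin n) → 2 * index i < n → d i ≤ index i →
       index j ≡ (n ∸ index i) + t → n ∸ index i ≤ d j) →
    DegreeCondition t G
  degreeCondition {t} cond (suc k) _ 2k<n k≤# with t ℕ.≤? suc k
  -- The sequence has no position n - (k + 1) + t in this case, but the bound is then trivial.
  ... | no t≰k = ℕ.≤-trans (ℕ.≰⇒> t≰k) (ℕ.m≤n+m t _)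
  ... | yes t≤k = ℕ.+-cancelˡ-≤ (n ∸ suc k) _ _ (begin
      n ∸ suc k + suc (suc k)      ≡⟨ ℕ.+-suc (n ∸ suc k) (suc k) ⟩
      suc (n ∸ suc k + suc k)      ≡⟨ cong suc (ℕ.m∸n+n≡m k<n) ⟩
      -- The additional 1 turns `toℕ j` into the one-based `index j`.
      suc n                        ≤⟨ s≤s (d≥⇒#≥ j (cond i j 2i<n di≤ index-j)) ⟩
      suc (# (λ v → n ∸ index i ℕ.≤? degree G v) + toℕ j) ≡⟨ ℕ.+-suc _ (toℕ j) ⟨
      # (λ v → n ∸ index i ℕ.≤? degree G v) + index j     ≡⟨ cong (λ m → # (λ v → n ∸ m ℕ.≤? degree G v) + index j) index-i ⟩
      h + index j                  ≡⟨ cong (h +_) (trans index-j (cong (λ m → n ∸ m + t) index-i)) ⟩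
      h + (n ∸ suc k + t)          ≡⟨ ℕ.+-assoc h _ t ⟨
      h + (n ∸ suc k) + t          ≡⟨ cong (_+ t) (ℕ.+-comm h (n ∸ suc k)) ⟩
      n ∸ suc k + h + t            ≡⟨ ℕ.+-assoc (n ∸ suc k) h t ⟩
      n ∸ suc k + (h + t)          ∎)
    where
    open ℕ.≤-Reasoning
    h = # (λ v → n ∸ suc k ℕ.≤? degree G v)

    1+k<n : suc k < n
    1+k<n = ℕ.≤-<-trans (ℕ.m≤m+n (suc k) _) 2k<n

    k<n : k < n
    k<n = ℕ.<⇒≤ 1+k<n

    i : Fin n
    i = Fin.fromℕ< k<n

    index-i : index i ≡ suc k
    index-i = cong suc (Fin.toℕ-fromℕ< k<n)

    2i<n : 2 * index i < n
    2i<n = subst (λ m → 2 * m < n) (sym index-i) 2k<n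

    di≤ : d i ≤ index i
    di≤ = subst (d i ≤_) (sym index-i) (#≥⇒d≤ i (ℕ.≤-trans (ℕ.≤-reflexive index-i) k≤#))

    bound : n ∸ suc k + t ≤ n
    bound = ℕ.≤-trans (ℕ.+-monoʳ-≤ _ t≤k) (ℕ.≤-reflexive (ℕ.m∸n+n≡m k<n))

    positive : 1 ≤ n ∸ suc k + t
    positive = ℕ.≤-trans (ℕ.m<n⇒0<n∸m 1+k<n) (ℕ.m≤m+n _ t)

    j<n : pred (n ∸ suc k + t) < n
    j<n = subst (_≤ n) (sym (ℕ.suc-pred _ ⦃ >-nonZero positive ⦄)) bound

    j : Fin n
    j = Fin.fromℕ< j<n

    index-j : index j ≡ (n ∸ index i) + t
    index-j = trans (cong suc (Fin.toℕ-fromℕ< j<n))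
      (trans (ℕ.suc-pred _ ⦃ >-nonZero positive ⦄) (cong (λ m → n ∸ m + t) (sym index-i)))

-- Walks and Hamiltonian cycles

-- With the vertex list as an index, surgery on walks is concatenation and reversal of lists, and
-- spanning is preserved because the result is a permutation.
data Walk {A : Set} (R : Rel A 0ℓ) : A → A → List A → Set where
  stop : ∀ u → Walk R u u [ u ]
  step : ∀ {u v w ws} → R u w → Walk R w v ws → Walk R u v (u ∷ ws)

data Follows {A : Set} (u v : A) : List A → Set where
  now   : ∀ {ws} → Follows u v (u ∷ v ∷ ws)
  later : ∀ {w ws} → Follows u v ws → Follows u v (w ∷ ws)

module _ {A : Set} where

  Follows⇒∈ˡ : ∀ {u v : A} {ws} → Follows u v ws → u ∈ ws
  Follows⇒∈ˡ now       = here refl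
  Follows⇒∈ˡ (later f) = there (Follows⇒∈ˡ f)

  -- Membership in the tail is what contradicts uniqueness: in a list without repetitions the head
  -- follows nothing.
  Follows⇒∈ʳ : ∀ {u v w : A} {ws} → Follows u v (w ∷ ws) → v ∈ ws
  Follows⇒∈ʳ now                 = here refl
  Follows⇒∈ʳ (later f@now)       = there (Follows⇒∈ʳ f)
  Follows⇒∈ʳ (later f@(later _)) = there (Follows⇒∈ʳ f)

  Follows-functionalˡ : ∀ {u u′ v : A} {ws} → Unique ws → Follows u v ws → Follows u′ v ws → u ≡ u′
  Follows-functionalˡ _ now now = refl
  Follows-functionalˡ (_ ∷ uq) now (later f) = contradiction (Follows⇒∈ʳ f) (Unique.Unique[x∷xs]⇒x∉xs uq)
  Follows-functionalˡ (_ ∷ uq) (later f) now = contradiction (Follows⇒∈ʳ f) (Unique.Unique[x∷xs]⇒x∉xs uq)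
  Follows-functionalˡ (_ ∷ uq) (later f) (later g) = Follows-functionalˡ uq f g

  Follows-functionalʳ : ∀ {u v v′ : A} {ws} → Unique ws → Follows u v ws → Follows u v′ ws → v ≡ v′
  Follows-functionalʳ _ now now = refl
  Follows-functionalʳ uq now (later f) = contradiction (Follows⇒∈ˡ f) (Unique.Unique[x∷xs]⇒x∉xs uq)
  Follows-functionalʳ uq (later f) now = contradiction (Follows⇒∈ˡ f) (Unique.Unique[x∷xs]⇒x∉xs uq)
  Follows-functionalʳ (_ ∷ uq) (later f) (later g) = Follows-functionalʳ uq f g

  Follows-++⁺ʳ : ∀ {u v : A} as {bs} → Follows u v bs → Follows u v (as ++ bs)
  Follows-++⁺ʳ []       f = f
  Follows-++⁺ʳ (_ ∷ as) f = later (Follows-++⁺ʳ as f)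

  Follows-++⁺ˡ : ∀ {u v : A} {as bs} → Follows u v as → Follows u v (as ++ bs)
  Follows-++⁺ˡ now       = now
  Follows-++⁺ˡ (later f) = later (Follows-++⁺ˡ f)

  module _ {R : Rel A 0ℓ} where

    start∈ : ∀ {u v ws} → Walk R u v ws → u ∈ ws
    start∈ (stop _)   = here refl
    start∈ (step _ _) = here refl

    end∈ : ∀ {u v ws} → Walk R u v ws → v ∈ ws
    end∈ (stop _)   = here refl
    end∈ (step _ p) = there (end∈ p)

    join : ∀ {u v w z as bs} → Walk R u v as → R v w → Walk R w z bs → Walk R u z (as ++ bs)
    join (stop _)   r q = step r q
    join (step e p) r q = step e (join p r q)

    reverseWalk : (∀ {u v} → R u v → R v u) → ∀ {u v ws} → Walk R u v ws → Walk R v u (reverse ws)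
    reverseWalk R-sym (stop u) = stop u
    reverseWalk R-sym (step {u} {ws = ws} e p) =
      subst (Walk R _ u) (sym (List.unfold-reverse u ws)) (join (reverseWalk R-sym p) (R-sym e) (stop u))

    join-Follows : ∀ {u v w z as bs} → Walk R u v as → Walk R w z bs → Follows v w (as ++ bs)
    join-Follows (stop _)   (stop _)   = now
    join-Follows (stop _)   (step _ _) = now
    join-Follows (step _ p) q          = later (join-Follows p q)

    record Cut (x y : A) (ws : List A) (u v : A) : Set where
      constructor mkCut
      field
        {before after} : List A
        walkTo         : Walk R x u before
        edge           : R u v
        walkFrom       : Walk R v y after
        split          : before ++ after ≡ ws

      follows : Follows u v ws
      follows = subst (Follows u v) split (join-Follows walkTo walkFrom)

    cut : ∀ {x y v ws} → Walk R x y ws → v ∈ ws → v ≡ x ⊎ ∃ λ u → Cut x y ws u v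
    cut (stop _)   (here refl) = inj₁ refl
    cut (step _ _) (here refl) = inj₁ refl
    cut {x} (step e p) (there v∈) with cut p v∈
    ... | inj₁ refl                      = inj₂ (x , mkCut (stop x) e p refl)
    ... | inj₂ (u , mkCut q e′ r refl) = inj₂ (u , mkCut (step e q) e′ r refl)

    Linked⇒Walk : ∀ u ws {s} → Linked R (u ∷ ws ∷ʳ s) → ∃ λ v → Walk R u v (u ∷ ws) × R v s
    Linked⇒Walk u []       (e ∷ [-]) = u , stop u , e
    Linked⇒Walk u (w ∷ ws) (e ∷ l)   with v , p , e′ ← Linked⇒Walk w ws l = v , step e p , e′

    Walk⇒Linked : ∀ {u v s ws} → Walk R u v ws → R v s → Linked R (ws ∷ʳ s)
    Walk⇒Linked (stop _)              r = r ∷ [-]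
    Walk⇒Linked (step e p@(stop _))   r = e ∷ Walk⇒Linked p r
    Walk⇒Linked (step e p@(step _ _)) r = e ∷ Walk⇒Linked p r

Spanning : List (Fin n) → Set
Spanning ws = Unique ws × (∀ v → v ∈ ws)

Spanning-resp-↭ : ∀ {vs ws : List (Fin n)} → vs ↭ ws → Spanning vs → Spanning ws
Spanning-resp-↭ {n} p (unique , total) = ↭ₛ.Unique-resp-↭ (↭⇒↭ₛ p) unique , λ v → ↭.∈-resp-↭ p (total v)
  where import Data.List.Relation.Binary.Permutation.Setoid.Properties (setoid (Fin n)) as ↭ₛ

Spanning-length : ∀ {ws : List (Fin n)} → Spanning ws → n ≤ length ws
Spanning-length {n} {ws} (_ , total) =
  subst (_≤ length ws) (List.length-tabulate id) (length-mono-⊆ (Unique.allFin⁺ n) λ {v} _ → total v)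

module _ (G : Graph n) where
  open Graph G using (_~_) renaming (sym to ~-sym)

  HamiltonianPath : Fin n → Fin n → Set
  HamiltonianPath x y = ∃ λ ws → Walk _~_ x y ws × Spanning ws

  close : 3 ≤ n → ∀ {u v ws} → Walk _~_ u v ws → v ~ u → Spanning ws → Hamiltonian G
  close 3≤n {u} p e span@(unique , total) = cycle p e unique (ℕ.≤-trans 3≤n (Spanning-length span)) total
    where
    -- The two clauses coincide; matching on the walk only reveals that its list starts with `u`, as
    -- `Cycle` requires.
    cycle : ∀ {v ws} → Walk _~_ u v ws → v ~ u → Unique ws → 3 ≤ length ws → (∀ w → w ∈ ws) → Hamiltonian G
    cycle p@(stop _)   e unique long total = record { distinct = unique; long = long; closed = Walk⇒Linked p e } , total
    cycle p@(step _ _) e unique long total = record { distinct = unique; long = long; closed = Walk⇒Linked p e } , total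

  complete⇒hamiltonian : 3 ≤ n → (∀ u v → u ≢ v → u ~ v) → Hamiltonian G
  complete⇒hamiltonian 3≤n complete = go (subst (3 ≤_) (sym (List.length-tabulate id)) 3≤n) (Unique.allFin⁺ n , ∈-allFin)
    where
    walk : ∀ u us → Unique (u ∷ us) → ∃ λ v → Walk _~_ u v (u ∷ us)
    walk u []       _ = u , stop u
    walk u (v ∷ us) ((u≢v ∷ _) ∷ uq) with w , p ← walk v us uq = w , step (complete u v u≢v) p

    go : ∀ {us} → 3 ≤ length us → Spanning us → Hamiltonian G
    go {_ ∷ []} (s≤s ())
    go {u ∷ v ∷ us} _ span@(unique , _) with walk u (v ∷ us) unique
    ... | w , p@(step _ q) =
      close 3≤n p (complete w u λ { refl → Unique.Unique[x∷xs]⇒x∉xs unique (end∈ q) }) span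

  -- The cycle follows the path from `x` to `u`, jumps to `y`, runs backwards to `v` and closes at
  -- `x`.
  crossing : 3 ≤ n → ∀ {x y u v ws} → Cut {R = _~_} x y ws u v → Spanning ws → u ~ y → v ~ x → Hamiltonian G
  crossing 3≤n (mkCut {as} {bs} p _ q refl) span u~y v~x =
    close 3≤n (join p u~y (reverseWalk ~-sym q)) v~x
      (Spanning-resp-↭ (↭.++⁺ˡ as (↭-sym (↭.↭-reverse bs))) span)

  -- The cycle runs through bs, then backwards through as, then through cs.
  exchange : 3 ≤ n → ∀ {x y u v u′ v′ as bs cs} →
             Walk _~_ x u as → Walk _~_ v u′ bs → Walk _~_ v′ y cs → Spanning (as ++ bs ++ cs) →
             u′ ~ u → x ~ v′ → y ~ v → Hamiltonian G
  exchange 3≤n {as = as} {bs} {cs} p q r span u′~u x~v′ y~v =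
    close 3≤n (join q u′~u (join (reverseWalk ~-sym p) x~v′ r)) y~v (Spanning-resp-↭ perm span)
    where
    perm : as ++ bs ++ cs ↭ bs ++ reverse as ++ cs
    perm = ↭-trans (↭.shifts as bs) (↭.++⁺ˡ bs (↭.++⁺ʳ cs (↭-sym (↭.↭-reverse as))))

-- Adding an edge

module _ (G : Graph n) {x y : Fin n} (x≢y : x ≢ y) where
  open Graph G using (_~_; _~?_) renaming (sym to ~-sym; irrefl to ~-irrefl)

  New : Rel (Fin n) 0ℓ
  New u v = (u ≡ x × v ≡ y) ⊎ (u ≡ y × v ≡ x)

  New-sym : ∀ {u v} → New u v → New v u
  New-sym (inj₁ (p , q)) = inj₂ (q , p)
  New-sym (inj₂ (p , q)) = inj₁ (q , p)

  New-unique : ∀ {a b u v} → New a b → New u v → (u ≡ a × v ≡ b) ⊎ (u ≡ b × v ≡ a)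
  New-unique (inj₁ (refl , refl)) new = new
  New-unique (inj₂ (refl , refl)) (inj₁ p) = inj₂ p
  New-unique (inj₂ (refl , refl)) (inj₂ p) = inj₁ p

  New-irrefl : ∀ {u} → ¬ New u u
  New-irrefl (inj₁ (refl , p)) = x≢y p
  New-irrefl (inj₂ (refl , p)) = x≢y (sym p)

  addEdge : Graph n
  addEdge = record
    { _~_    = λ u v → u ~ v ⊎ New u v
    ; _~?_   = λ u v → (u ~? v) ⊎-dec (((u Fin.≟ x) ×-dec (v Fin.≟ y)) ⊎-dec ((u Fin.≟ y) ×-dec (v Fin.≟ x)))
    ; sym    = λ { (inj₁ e) → inj₁ (~-sym e) ; (inj₂ e) → inj₂ (New-sym e) }
    ; irrefl = λ { refl (inj₁ e) → ~-irrefl refl e ; refl (inj₂ e) → New-irrefl e }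
    }

  open Graph addEdge using () renaming (_~_ to _~⁺_)

  -- Using the new edge would put both of its ends on the walk, hence `b`.
  avoiding : ∀ {a b u v ws} → New a b → Walk _~⁺_ u v ws → b ∉ ws → Walk _~_ u v ws
  avoiding new (stop u) _ = stop u
  avoiding new (step (inj₁ e) p) b∉ = step e (avoiding new p (b∉ ∘ there))
  avoiding new (step (inj₂ e) p) b∉ with New-unique new e
  ... | inj₁ (_ , refl) = contradiction (there (start∈ p)) b∉
  ... | inj₂ (refl , _) = contradiction (here refl) b∉

  -- The new edge could only come first, since `b` does not recur; it would then lead straight to
  -- the end `a`, leaving a walk on two vertices.
  endpoints-unused : ∀ {a b ws} → New a b → Walk _~⁺_ b a ws → Unique ws → 3 ≤ length ws → Walk _~_ b a ws
  endpoints-unused new (stop u) _ (s≤s ())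
  endpoints-unused new (step (inj₁ e) p) uq _ = step e (avoiding new p (Unique.Unique[x∷xs]⇒x∉xs uq))
  endpoints-unused new (step (inj₂ e) p) uq 3≤ with New-unique new e
  ... | inj₁ (refl , _) = contradiction (end∈ p) (Unique.Unique[x∷xs]⇒x∉xs uq)
  endpoints-unused new (step (inj₂ e) (stop _)) uq (s≤s (s≤s ())) | inj₂ (_ , refl)
  endpoints-unused new (step (inj₂ e) (step _ p)) (_ ∷ uq) _ | inj₂ (_ , refl) =
    contradiction (end∈ p) (Unique.Unique[x∷xs]⇒x∉xs uq)

  firstNew : ∀ {u v ws} → Walk _~⁺_ u v ws → Walk _~_ u v ws ⊎
    ∃ λ a → ∃ λ b → Σ (Cut {R = _~⁺_} u v ws a b) λ _ → New a b
  firstNew (stop u) = inj₁ (stop u)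
  firstNew (step (inj₂ e) p) = inj₂ (_ , _ , mkCut (stop _) (inj₂ e) p refl , e)
  firstNew (step (inj₁ e) p) with firstNew p
  ... | inj₁ p′ = inj₁ (step e p′)
  ... | inj₂ (a , b , mkCut q e′ r refl , new) = inj₂ (a , b , mkCut (step (inj₁ e) q) e′ r refl , new)

  -- A cycle that uses the new edge is rotated until that edge closes it; what remains is a path in
  -- `G` between `x` and `y`.
  addEdge-hamiltonian : 3 ≤ n → Hamiltonian addEdge → Hamiltonian G ⊎ HamiltonianPath G x y
  addEdge-hamiltonian 3≤n (C , total)
    with v , p , e ← Linked⇒Walk (Graph.Cycle.start C) (Graph.Cycle.rest C) (Graph.Cycle.closed C) =
    open-up p e (Graph.Cycle.distinct C , total)
    where
    orient : ∀ {a b ws} → New a b → Walk _~⁺_ b a ws → Spanning ws → HamiltonianPath G x y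
    orient new p span@(unique , _) with endpoints-unused new p unique (ℕ.≤-trans 3≤n (Spanning-length span)) | new
    ... | q | inj₂ (refl , refl) = _ , q , span
    ... | q | inj₁ (refl , refl) = _ , reverseWalk ~-sym q , Spanning-resp-↭ (↭-sym (↭.↭-reverse _)) span

    open-up : ∀ {u v ws} → Walk _~⁺_ u v ws → v ~⁺ u → Spanning ws → Hamiltonian G ⊎ HamiltonianPath G x y
    open-up p (inj₂ new) span = inj₂ (orient new p span)
    open-up p (inj₁ e) span with firstNew p
    ... | inj₁ q = inj₁ (close G 3≤n q e span)
    -- The cycle restarts just behind the new edge, with the old closing edge `e` now in its middle.
    ... | inj₂ (_ , _ , mkCut {as} {bs} q _ r refl , new) =
      inj₂ (orient new (join r (inj₁ e) q) (Spanning-resp-↭ (↭.++-comm as bs) span))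

degree-mono : {G H : Graph n} → (∀ {u v} → Graph._~_ G u v → Graph._~_ H u v) → ∀ v → degree G v ≤ degree H v
degree-mono {G = G} {H} G⊆H v = subst₂ _≤_ (sym (degree≡# G v)) (sym (degree≡# H v))
  (#-mono (Graph._~?_ G v) (Graph._~?_ H v) G⊆H)

-- Degrees can only grow, so the premise at `k` for `H` implies the one for `G`, and the conclusion
-- for `G` the one for `H`.
degreeCondition-mono : {t : ℕ} {G H : Graph n} → (∀ {u v} → Graph._~_ G u v → Graph._~_ H u v) →
                       DegreeCondition t G → DegreeCondition t H
degreeCondition-mono {n} {t} {G} {H} G⊆H cond k 1≤k 2k<n k≤# =
  ℕ.≤-trans
    (cond k 1≤k 2k<n (ℕ.≤-trans k≤# (#-mono (λ v → degree H v ℕ.≤? k) (λ v → degree G v ℕ.≤? k)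
      λ {v} → ℕ.≤-trans (deg≤ v))))
    (ℕ.+-monoˡ-≤ t (#-mono (λ v → n ∸ k ℕ.≤? degree G v) (λ v → n ∸ k ℕ.≤? degree H v)
      λ {v} le → ℕ.≤-trans le (deg≤ v)))
  where
  deg≤ : ∀ v → degree G v ≤ degree H v
  deg≤ = degree-mono {G = G} {H} G⊆H

-- Ordered pairs are counted, the diagonal included; only the strict decrease under `addEdge`
-- matters.
nonEdges : Graph n → ℕ
nonEdges {n} G = length (filter (λ (u , v) → ¬? (Graph._~?_ G u v)) (cartesianProduct (allFin n) (allFin n)))

nonEdges-addEdge : (G : Graph n) {x y : Fin n} (x≢y : x ≢ y) → ¬ Graph._~_ G x y →
                   nonEdges (addEdge G x≢y) < nonEdges G
nonEdges-addEdge {n} G {x} {y} x≢y x≁y = length-mono-⊆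
  -- Putting `(x , y)` in front of the surviving pairs still gives distinct old non-edges; this
  -- extra element makes the inequality strict.
  (All.tabulate (λ z∈ → λ { refl → proj₂ (∈-filter⁻ notAdj⁺? {xs = pairs} z∈) (inj₂ (inj₁ (refl , refl))) })
    ∷ Unique.filter⁺ notAdj⁺? (Unique.cartesianProduct⁺ (Unique.allFin⁺ n) (Unique.allFin⁺ n)))
  λ { (here refl) → ∈-filter⁺ notAdj? (∈-cartesianProduct⁺ (∈-allFin x) (∈-allFin y)) x≁y
    ; (there z∈)  → let z∈pairs , z≁ = ∈-filter⁻ notAdj⁺? {xs = pairs} z∈ in ∈-filter⁺ notAdj? z∈pairs (z≁ ∘ inj₁) }
  where
  pairs : List (Fin n × Fin n)
  pairs = cartesianProduct (allFin n) (allFin n)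

  notAdj? : Decidable (λ (u , v) → ¬ Graph._~_ G u v)
  notAdj? (u , v) = ¬? (Graph._~?_ G u v)

  notAdj⁺? : Decidable (λ (u , v) → ¬ Graph._~_ (addEdge G x≢y) u v)
  notAdj⁺? (u , v) = ¬? (Graph._~?_ (addEdge G x≢y) u v)

-- Universal vertices and their predecessors on a Hamiltonian path

module _ (G : Graph n) where
  open Graph G using (_~_; _~?_) renaming (sym to ~-sym; irrefl to ~-irrefl)

  NonNeighbour : Rel (Fin n) 0ℓ
  NonNeighbour v u = u ≢ v × ¬ v ~ u

  nonNeighbour? : ∀ v → Decidable (NonNeighbour v)
  nonNeighbour? v u = ¬? (u Fin.≟ v) ×-dec ¬? (v ~? u)

  NonNeighbour-sym : ∀ {u v} → NonNeighbour v u → NonNeighbour u v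
  NonNeighbour-sym (u≢v , v≁u) = u≢v ∘ sym , v≁u ∘ ~-sym

  Universal : Fin n → Set
  Universal v = ¬ ∃ (NonNeighbour v)

  nonuniversal? : Decidable (∃ ∘ NonNeighbour)
  nonuniversal? v = Fin.any? (nonNeighbour? v)

  universal? : Decidable Universal
  universal? v = ¬? (nonuniversal? v)

  universal⇒~ : ∀ {u v} → Universal v → u ≢ v → v ~ u
  universal⇒~ {u} {v} univ u≢v = decidable-stable (v ~? u) λ v≁u → univ (u , u≢v , v≁u)

  universal≢ : ∀ {u v w} → NonNeighbour u w → Universal v → v ≢ u
  universal≢ nn univ refl = univ (_ , nn)

  ~universal : ∀ {u v w} → NonNeighbour u w → Universal v → u ~ v
  ~universal nn univ = ~-sym (universal⇒~ univ (universal≢ nn univ ∘ sym))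

  -- What the counting needs of a Hamiltonian path from `x` to `y` when there is no Hamiltonian
  -- cycle. `injective` leaves out `x`, which has no predecessor; the last two fields reflect that
  -- neither `crossing` nor `exchange` applies.
  record Predecessors (x y : Fin n) : Set where
    field
      pre           : Fin n → Fin n
      injective     : ∀ {u v} → u ≢ x → v ≢ x → pre u ≡ pre v → u ≡ v
      nonNeighbour  : ∀ {v} → x ~ v → NonNeighbour y (pre v)
      independent   : ∀ {u v} → Universal u → Universal v → ¬ pre u ~ pre v

  module _ (3≤n : 3 ≤ n) {x y : Fin n} (y≁x : NonNeighbour y x)
           {ws : List (Fin n)} (p : Walk _~_ x y ws) (span : Spanning ws) where

    -- The vertex x has no predecessor; the value there is junk.
    predecessor : ∀ v → ∃ λ u → v ≢ x → Cut {R = _~_} x y ws u v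
    predecessor v with cut p (proj₂ span v)
    ... | inj₁ v≡x     = x , contradiction v≡x
    ... | inj₂ (u , c) = u , λ _ → c

    before : Fin n → Fin n
    before v = proj₁ (predecessor v)

    cutBefore : ∀ {v} → v ≢ x → Cut {R = _~_} x y ws (before v) v
    cutBefore {v} = proj₂ (predecessor v)

    follows⇒before : ∀ {v w} → v ≢ x → Follows w v ws → w ≡ before v
    follows⇒before v≢x f = Follows-functionalˡ (proj₁ span) f (Cut.follows (cutBefore v≢x))

    before≢y : ∀ {v} → v ≢ x → before v ≢ y
    before≢y v≢x eq with cutBefore v≢x
    ... | mkCut q _ r refl = Unique-++⇒disjoint (proj₁ span) (end∈ q) (subst (_∈ _) (sym eq) (end∈ r))

    -- The path is cut in front of both universal vertices, and `exchange` rejoins the three pieces: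
    -- the given edge links the predecessors, and universality supplies the edges at `x` and `y`.
    before~before⇒hamiltonian : ∀ {u v} → Universal u → Universal v → before u ~ before v → Hamiltonian G
    before~before⇒hamiltonian {u} {v} univᵤ univᵥ e with cutBefore (universal≢ (NonNeighbour-sym y≁x) univᵤ)
    ... | mkCut {as} q _ r refl with ∈-++⁻ as (proj₂ span v)
    -- Here `v` precedes `u` on the path.
    ...   | inj₁ v∈as with cut q v∈as
    ...     | inj₁ v≡x = contradiction v≡x (universal≢ (NonNeighbour-sym y≁x) univᵥ)
    ...     | inj₂ (_ , c@(mkCut {as₁} {as₂} q₁ _ q₂ refl))
          -- The predecessor found on the shorter walk is `before v`, because the vertices of the
          -- path are distinct.
          with refl ← follows⇒before (universal≢ (NonNeighbour-sym y≁x) univᵥ) (Follows-++⁺ˡ (Cut.follows c)) =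
          exchange G 3≤n q₁ q₂ r (subst Spanning (List.++-assoc as₁ as₂ _) span)
            e (~universal (NonNeighbour-sym y≁x) univᵤ) (~universal y≁x univᵥ)
    before~before⇒hamiltonian univᵤ univᵥ e | mkCut {as} q _ r refl | inj₂ v∈bs with cut r v∈bs
    -- If `v` is `u` itself, then `e` is a loop.
    ...     | inj₁ refl = contradiction e (~-irrefl refl)
    ...     | inj₂ (_ , c@(mkCut r₁ _ r₂ refl))
          with refl ← follows⇒before (universal≢ (NonNeighbour-sym y≁x) univᵥ) (Follows-++⁺ʳ as (Cut.follows c)) =
          exchange G 3≤n q r₁ r₂ span (~-sym e) (~universal (NonNeighbour-sym y≁x) univᵥ) (~universal y≁x univᵤ)

    predecessors : Hamiltonian G ⊎ Predecessors x y
    predecessors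
      with Fin.any? (λ v → (x ~? v) ×-dec (before v ~? y))
         | Fin.any? (λ u → Fin.any? λ v → universal? u ×-dec (universal? v ×-dec (before u ~? before v)))
    ... | yes (v , x~v , e) | _ =
      inj₁ (crossing G 3≤n (cutBefore λ { refl → ~-irrefl refl x~v }) span e (~-sym x~v))
    ... | no _ | yes (u , v , univᵤ , univᵥ , e) = inj₁ (before~before⇒hamiltonian univᵤ univᵥ e)
    ... | no ¬crossing | no ¬exchange = inj₂ record
      { pre          = before
      ; injective    = λ {u} {v} u≢x v≢x eq → Follows-functionalʳ (proj₁ span)
          (subst (λ w → Follows w u ws) eq (Cut.follows (cutBefore u≢x)))
          (Cut.follows (cutBefore v≢x))
      ; nonNeighbour = λ {v} x~v →
          before≢y (λ { refl → ~-irrefl refl x~v }) , λ y~u → ¬crossing (v , x~v , ~-sym y~u)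
      ; independent  = λ {u} {v} univᵤ univᵥ e → ¬exchange (u , v , univᵤ , univᵥ , e)
      }

  -- Counting against toughness

  module _ {t : ℕ} (tough : Tough t G) {x y : Fin n} (y≁x : NonNeighbour y x)
           (P : Predecessors x y) where
    open Predecessors P

    universals : List (Fin n)
    universals = members universal?

    ω : ℕ
    ω = # universal?

    x≁y : NonNeighbour x y
    x≁y = NonNeighbour-sym y≁x

    -- Ore's rotation: `pre` maps the neighbours of `x` injectively to non-neighbours of `y`.
    degree-x≤ : degree G x ≤ # (nonNeighbour? y)
    degree-x≤ = subst (_≤ # (nonNeighbour? y)) (trans (List.length-map pre (members (x ~?_))) (sym (degree≡# G x)))
      (length≤# (nonNeighbour? y)
        (Unique-map⁺ (λ u∈ v∈ → injective (≢x u∈) (≢x v∈)) (members-unique (x ~?_)))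
        λ z∈ → let _ , v∈ , eq = ∈-map⁻ pre z∈ in subst (NonNeighbour y) (sym eq) (nonNeighbour (∈-members⁻ (x ~?_) v∈)))
      where
      ≢x : ∀ {v} → v ∈ members (x ~?_) → v ≢ x
      ≢x v∈ refl = ~-irrefl refl (∈-members⁻ (x ~?_) v∈)

    -- Deleting the neighbours of `x` isolates `x` and leaves `y` in another component.
    tough-nonNeighbour : t * 2 ≤ degree G x
    tough-nonNeighbour = subst (t * 2 ≤_) (trans (∣subsetOf∣ (x ~?_)) (sym (degree≡# G x)))
      (tough-isolated t G tough (subsetOf (x ~?_)) ((y≢x ∷ []) ∷ [] ∷ [])
        ((proj₂ y≁x ∘ ~-sym ∘ ∈-subsetOf⁻ (x ~?_)) ∷ (~-irrefl refl ∘ ∈-subsetOf⁻ (x ~?_)) ∷ [])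
        ((λ _ → ∈-subsetOf⁺ (x ~?_)) ∷ []) (s≤s z≤n))
      where
      y≢x : y ≢ x
      y≢x = proj₁ y≁x ∘ sym

    -- S consists of the neighbours of the predecessors of the universal vertices; in G - S these
    -- predecessors are isolated, and y lies in yet another component.
    tough-universals : 1 ≤ ω → ∀ {r} → (∀ {v} → NonNeighbour y v → degree G v ≤ ω + r) →
                       t * suc ω ≤ ω + ω * r
    tough-universals 1≤ω {r} deg≤ = ℕ.≤-trans
      (subst (λ l → t * suc l ≤ ∣ S ∣) length-us
        (tough-isolated t G tough S (y∉us ∷ us-unique) (y∉S ∷ us∉S) us-isolated (subst (1 ≤_) (sym length-us) 1≤ω)))
      S≤
      where
      us : List (Fin n)
      us = map pre universals

      length-us : length us ≡ ω
      length-us = List.length-map pre universals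

      hit? : Decidable (λ v → Any.Any (_~ v) us)
      hit? v = Any.any? (_~? v) us

      S : Subset n
      S = subsetOf hit?

      us-unique : Unique us
      us-unique = Unique-map⁺
        (λ u∈ v∈ → injective (universal≢ x≁y (∈-members⁻ universal? u∈)) (universal≢ x≁y (∈-members⁻ universal? v∈)))
        (members-unique universal?)

      us-nonNeighbour : All (NonNeighbour y) us
      us-nonNeighbour = All.tabulate λ z∈ →
        let _ , v∈ , eq = ∈-map⁻ pre z∈
        in subst (NonNeighbour y) (sym eq) (nonNeighbour (~universal x≁y (∈-members⁻ universal? v∈)))

      us-independent : ∀ {u v} → u ∈ us → v ∈ us → ¬ u ~ v
      us-independent u∈ v∈ e
        with _ , u∈′ , refl ← ∈-map⁻ pre u∈ | _ , v∈′ , refl ← ∈-map⁻ pre v∈ =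
        independent (∈-members⁻ universal? u∈′) (∈-members⁻ universal? v∈′) e

      y∉us : All (y ≢_) us
      y∉us = All.map (λ (u≢y , _) → u≢y ∘ sym) us-nonNeighbour

      y∉S : y Subset.∉ S
      y∉S y∈S with _ , u∈ , e ← find (∈-subsetOf⁻ hit? y∈S) = proj₂ (All.lookup us-nonNeighbour u∈) (~-sym e)

      us∉S : All (Subset._∉ S) us
      us∉S = All.tabulate λ v∈ v∈S →
        let _ , u∈ , e = find (∈-subsetOf⁻ hit? v∈S) in us-independent u∈ v∈ e

      us-isolated : All (λ u → ∀ w → u ~ w → w Subset.∈ S) us
      us-isolated = All.tabulate λ u∈ w e → ∈-subsetOf⁺ hit? (lose u∈ e)

      -- Universal neighbours are shared by all of `us` and counted once; only the others are
      -- counted separately for each `u`.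
      private? : ∀ u → Decidable (λ v → u ~ v × ∃ (NonNeighbour v))
      private? u v = (u ~? v) ×-dec nonuniversal? v

      extra : Fin n → List (Fin n)
      extra u = members (private? u)

      extra≤ : All (λ u → length (extra u) ≤ r) us
      -- Being a non-neighbour of `y`, `u` is not universal, so all `ω` universal vertices are among
      -- its at most `ω + r` neighbours.
      extra≤ = All.map (λ {u} nn → ℕ.+-cancelˡ-≤ ω _ _ (ℕ.≤-trans (total u nn) (deg≤ nn))) us-nonNeighbour
        where
        total : ∀ u → NonNeighbour y u → ω + length (extra u) ≤ degree G u
        total u nn = subst₂ _≤_ (List.length-++ universals) (sym (degree≡# G u))
          (length≤# (u ~?_)
            (Unique.++⁺ (members-unique universal?) (members-unique (private? u))
              λ (v∈ , v∈′) → ∈-members⁻ universal? v∈ (proj₂ (∈-members⁻ (private? u) v∈′)))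
            adjacent)
          where
          adjacent : ∀ {v} → v ∈ universals ++ extra u → u ~ v
          adjacent v∈ with ∈-++⁻ universals v∈
          ... | inj₁ v∈′ = ~universal (NonNeighbour-sym nn) (∈-members⁻ universal? v∈′)
          ... | inj₂ v∈′ = proj₁ (∈-members⁻ (private? u) v∈′)

      covered : ∀ {v} → Any.Any (_~ v) us → v ∈ universals ++ concatMap extra us
      covered {v} hit with nonuniversal? v
      ... | no univ    = ∈-++⁺ˡ (∈-members⁺ universal? univ)
      ... | yes nonuni = ∈-++⁺ʳ universals (∈-concatMap⁺ extra
                           (Any.map (λ {u} e → ∈-members⁺ (private? u) (e , nonuni)) hit))

      S≤ : ∣ S ∣ ≤ ω + ω * r
      S≤ = begin
        ∣ S ∣                                   ≡⟨ ∣subsetOf∣ hit? ⟩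
        # hit?                                  ≤⟨ #≤length hit? covered ⟩
        length (universals ++ concatMap extra us) ≡⟨ List.length-++ universals ⟩
        ω + length (concatMap extra us)         ≤⟨ ℕ.+-monoʳ-≤ ω (length-concatMap-≤ extra extra≤) ⟩
        ω + length us * r                       ≡⟨ cong (λ l → ω + l * r) length-us ⟩
        ω + ω * r                               ∎
        where open ℕ.≤-Reasoning

    impossible : 3 ≤ n → 1 ≤ t → DegreeCondition t G →
      (∀ {v} → ∃ (NonNeighbour v) → degree G v ≤ degree G y) →
      (∀ {v} → NonNeighbour y v → degree G v ≤ degree G x) → ⊥
    impossible 3≤n 1≤t cond y-max x-max = by-cases (1 ℕ.≤? ω)
      where
      open ℕ.≤-Reasoning

      -- The left side is `ω * t`, which falls short of the right side by `t`.
      ω+ω*r<t*[1+ω] : ∀ t ω → 1 ≤ t → ω + ω * pred t < t * suc ω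
      ω+ω*r<t*[1+ω] (suc r) ω _ = s≤s (ℕ.+-monoʳ-≤ ω
        (ℕ.≤-trans (ℕ.≤-reflexive (ℕ.*-comm ω r)) (ℕ.*-monoʳ-≤ r (ℕ.n≤1+n ω))))

      k≤ω+r : ∀ {k} t ω → 1 ≤ t → k < ω + t → k ≤ ω + pred t
      k≤ω+r {k} (suc r) ω _ k<ω+t = ℕ.≤-pred (subst (k <_) (ℕ.+-suc ω r) k<ω+t)

      q h k i : ℕ
      q = # (nonNeighbour? y)
      -- The largest integer with `2 * h < n`; `q` may exceed it, hence the minimum in `k`.
      h = ⌊ pred n /2⌋
      k = q ⊓ h
      i = degree G x

      -- The `suc` accounts for `y` itself, which is counted neither in its degree nor in `q`.
      degree-y+q : suc (degree G y + q) ≤ n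
      degree-y+q = begin
        suc (degree G y + q)             ≡⟨ ℕ.+-suc (degree G y) q ⟨
        degree G y + suc q               ≤⟨ ℕ.+-monoʳ-≤ (degree G y) (length≤# (¬? ∘ (y ~?_)) unique nonadjacent) ⟩
        degree G y + # (¬? ∘ (y ~?_))    ≡⟨ cong (_+ # (¬? ∘ (y ~?_))) (degree≡# G y) ⟩
        # (y ~?_) + # (¬? ∘ (y ~?_))     ≡⟨ #-complement (y ~?_) ⟩
        n                                ∎
        where
        unique : Unique (y ∷ members (nonNeighbour? y))
        unique = All.tabulate (λ v∈ → proj₁ (∈-members⁻ (nonNeighbour? y) v∈) ∘ sym) ∷ members-unique (nonNeighbour? y)

        nonadjacent : ∀ {v} → v ∈ y ∷ members (nonNeighbour? y) → ¬ y ~ v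
        nonadjacent (here refl) = ~-irrefl refl
        nonadjacent (there v∈)  = proj₂ (∈-members⁻ (nonNeighbour? y) v∈)

      i≤k : i ≤ k
      -- As `x` is not universal, `i ≤ degree G y`; with `i ≤ q` this gives `i + i ≤ n - 1`, hence
      -- `i ≤ h`.
      i≤k = ℕ.⊓-glb degree-x≤ (subst (_≤ h) (sym (ℕ.n≡⌊n+n/2⌋ i)) (ℕ.⌊n/2⌋-mono (ℕ.≤-trans
        (ℕ.+-mono-≤ (y-max (y , x≁y)) degree-x≤) (ℕ.pred-mono-≤ degree-y+q))))

      1≤k : 1 ≤ k
      1≤k = ℕ.⊓-glb (∈-length (∈-members⁺ (nonNeighbour? y) y≁x)) (ℕ.⌊n/2⌋-mono (ℕ.pred-mono-≤ 3≤n))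

      2k<n : 2 * k < n
      2k<n = begin-strict
        2 * k             ≡⟨ cong (k +_) (ℕ.+-identityʳ k) ⟩
        k + k             ≤⟨ ℕ.+-mono-≤ (ℕ.m⊓n≤n q h) (ℕ.≤-trans (ℕ.m⊓n≤n q h) (ℕ.⌊n/2⌋≤⌈n/2⌉ (pred n))) ⟩
        h + ⌈ pred n /2⌉  ≡⟨ ℕ.⌊n/2⌋+⌈n/2⌉≡n (pred n) ⟩
        pred n            <⟨ ℕ.≤-reflexive (ℕ.suc-pred n ⦃ >-nonZero (ℕ.≤-trans (s≤s z≤n) 3≤n) ⦄) ⟩
        n                 ∎

      many-low : k ≤ # (λ v → degree G v ℕ.≤? k)
      -- The `q` non-neighbours of `y` serve as the low vertices, their degrees being at most `i`.
      many-low = ℕ.≤-trans (ℕ.m⊓n≤m q h)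
        (#-mono (nonNeighbour? y) (λ v → degree G v ℕ.≤? k) λ nn → ℕ.≤-trans (x-max nn) i≤k)

      high⇒universal : ∀ {v} → n ∸ k ≤ degree G v → Universal v
      -- A vertex that is not universal has degree at most `degree G y`, which is below `n - q` and
      -- so below `n - k`.
      high⇒universal {v} high nonuniversal = ℕ.<-irrefl refl (begin-strict
        n                     ≤⟨ ℕ.m≤n+m∸n n k ⟩
        k + (n ∸ k)           ≤⟨ ℕ.+-mono-≤ (ℕ.m⊓n≤m q h) (ℕ.≤-trans high (y-max nonuniversal)) ⟩
        q + degree G y        ≡⟨ ℕ.+-comm q (degree G y) ⟩
        degree G y + q        <⟨ degree-y+q ⟩
        n                     ∎)

      k<ω+t : k < ω + t
      k<ω+t = ℕ.≤-trans (cond k 1≤k 2k<n many-low)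
        (ℕ.+-monoˡ-≤ t (#-mono (λ v → n ∸ k ℕ.≤? degree G v) universal? high⇒universal))

      by-cases : Dec (1 ≤ ω) → ⊥
      by-cases (yes 1≤ω) = ℕ.<⇒≱ (ω+ω*r<t*[1+ω] t ω 1≤t)
        (tough-universals 1≤ω {pred t} λ nn → ℕ.≤-trans (x-max nn) (ℕ.≤-trans i≤k (k≤ω+r t ω 1≤t k<ω+t)))
      -- Without universal vertices `k < t`, although the degree `i ≤ k` of `x` is at least `t * 2`.
      by-cases (no ω≱1) = ℕ.<-irrefl refl (begin-strict
        k             <⟨ k<ω+t ⟩
        ω + t         ≡⟨ cong (_+ t) (ℕ.n<1⇒n≡0 (ℕ.≰⇒> ω≱1)) ⟩
        t             ≤⟨ ℕ.m≤m*n t 2 ⟩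
        t * 2         ≤⟨ tough-nonNeighbour ⟩
        i             ≤⟨ i≤k ⟩
        k             ∎)

-- Induction on the number of non-adjacent pairs

tough⇒hamiltonian : ∀ {t} → 1 ≤ t → 3 ≤ n → (G : Graph n) → Tough t G → DegreeCondition t G → Hamiltonian G
tough⇒hamiltonian {n} {t} 1≤t 3≤n G = go G (<-wellFounded (nonEdges G))
  where
  go : ∀ G → Acc _<_ (nonEdges G) → Tough t G → DegreeCondition t G → Hamiltonian G
  go G (acc rec) tough cond = by-cases (Fin.any? (nonuniversal? G))
    where
    fromPath : ∀ {x y} → NonNeighbour G y x →
               (∀ {v} → ∃ (NonNeighbour G v) → degree G v ≤ degree G y) →
               (∀ {v} → NonNeighbour G y v → degree G v ≤ degree G x) →
               HamiltonianPath G x y → Hamiltonian G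
    fromPath y≁x y-max x-max (_ , p , spanning) =
      [ id , (λ P → ⊥-elim (impossible G {t} tough y≁x P 3≤n 1≤t cond y-max x-max)) ]′
        (predecessors G 3≤n y≁x p spanning)

    hamiltonian⁺ : ∀ {x y} (y≁x : NonNeighbour G y x) → Hamiltonian (addEdge G (proj₁ y≁x))
    hamiltonian⁺ (x≢y , y≁x) = go (addEdge G x≢y)
      (rec (nonEdges-addEdge G x≢y (y≁x ∘ Graph.sym G)))
      (tough-mono {t = t} {G} {addEdge G x≢y} inj₁ tough)
      (degreeCondition-mono {t = t} {G} {addEdge G x≢y} inj₁ cond)

    by-cases : Dec (∃ λ v → ∃ (NonNeighbour G v)) → Hamiltonian G
    by-cases (no complete) = complete⇒hamiltonian G 3≤n λ u v u≢v →
      universal⇒~ G (λ nonuniversal → complete (u , nonuniversal)) (u≢v ∘ sym)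
    by-cases (yes incomplete) =
      -- The witness that `y` is not universal is what makes the choice of `x` among its
      -- non-neighbours possible.
      let y , nonuniversal , y-max = maximal (nonuniversal? G) (degree G) incomplete
          x , y≁x , x-max          = maximal (nonNeighbour? G y) (degree G) nonuniversal
      in [ id , fromPath y≁x y-max x-max ]′ (addEdge-hamiltonian G (proj₁ y≁x) 3≤n (hamiltonian⁺ y≁x))

theorem3 : ∀ (t : ℕ) → 4 ≤ t →
    ∀ (n : ℕ) → 3 ≤ n →
    ∀ (G : Graph n) → Tough t G →
    ∀ (d : Fin n → ℕ) → IsDegreeSequence G d →
    (∀ (i j : Fin n) → 2 * index i < n → d i ≤ index i →
    index j ≡ (n ∸ index i) + t → n ∸ index i ≤ d j) →
    Hamiltonian G
theorem3 t 4≤t n 3≤n G tough d isDegSeq cond =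
  tough⇒hamiltonian (ℕ.≤-trans (s≤s z≤n) 4≤t) 3≤n G tough (degreeCondition isDegSeq {t} cond)
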